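{- Let $\delta\in[0,1/10)$ and let $M,N\colon G\to\mathbb C$. Assume that $\Psi_{M,M}\neq0$ and $$|\Psi_M\Psi_{M,N}|\ge(1-\delta)\,|\Psi_N|\,\Psi_{M,M}.$$ Then $$\beta(N)\le(1+4\delta)\,\beta(M).$$
   Context: $G$ is an (indexing) set, $L\colon G\to\mathbb C$ is a function, and $w\colon G\to[0,\infty)$ is a weight function, not identically $0$. For $f\colon G\to\mathbb C$ put $\mathbb E^w_{\pi\in G}f(\pi):=\frac{\sum_{\pi\in G}w(\pi)f(\pi)}{\sum_{\pi\in G}w(\pi)}$. For $M,N\colon G\to\mathbb C$ define $\Psi_M:=\mathbb E^w_{\pi\in G}L(\pi)M(\pi)$, $\Psi_{M,N}:=\mathbb E^w_{\pi\in G}L(\pi)M(\pi)\overline{L(\pi)N(\pi)}$, and $\beta(M):=|\Psi_M|^2/\Psi_{M,M}$ if $\Psi_{M,M}\ne0$, $\beta(M):=0$ if $\Psi_{M,M}=0$. It is assumed that the series $\sum_\pi w(\pi)$ and $\sum_\pi w(\pi)|L(\pi)M(\pi)|^2$ converge for every function $M$ considered (automatic if $G$ is finite). -}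

module Defs where

open import Level using (Level; suc)
open import Algebra.Bundles using (CommutativeRing)
open import Algebra.Structures using (IsCommutativeRing)
open import Axiom.ExcludedMiddle using (ExcludedMiddle)
open import Data.List.Base using (List; foldr; map)
open import Data.List.Relation.Binary.Subset.Propositional using (_⊆_)
open import Data.List.Relation.Unary.Unique.Propositional using (Unique)
open import Data.Nat.Base using (ℕ)
open import Data.Product.Base using (∃; ∃-syntax; _×_; _,_; proj₁)
open import Relation.Binary.Core using (Rel)
open import Relation.Binary.Structures using (IsTotalOrder)
open import Relation.Nullary.Decidable.Core using (yes; no)
open import Relation.Nullary.Negation.Core using (¬_)
open import Relation.Unary using (Pred)
import Algebra.Definitions.RawMonoid as RawMonoidDefs
import Relation.Binary.Construct.NonStrictToStrict as ToStrict

-- The real numbers, given axiomatically: any two complete ordered fields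
-- are isomorphic (classically, by a unique isomorphism).
record CompleteOrderedField (ℓ : Level) : Set (suc ℓ) where
  infix  4 _≈_ _≉_ _≤_
  infixl 6 _+_
  infixl 7 _*_
  infix  8 -_
  field
    Carrier : Set ℓ
    _≈_     : Rel Carrier ℓ
    _≤_     : Rel Carrier ℓ
    _+_     : Carrier → Carrier → Carrier
    _*_     : Carrier → Carrier → Carrier
    -_      : Carrier → Carrier
    0#      : Carrier
    1#      : Carrier
    isCommutativeRing : IsCommutativeRing _≈_ _+_ _*_ -_ 0# 1#
    isTotalOrder      : IsTotalOrder _≈_ _≤_

  _≉_ : Rel Carrier ℓ
  x ≉ y = ¬ (x ≈ y)

  UpperBound : Pred Carrier ℓ → Pred Carrier ℓ
  UpperBound P u = ∀ x → P x → x ≤ u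

  field
    0≉1      : 0# ≉ 1#
    inverse  : ∀ x → x ≉ 0# → ∃[ y ] x * y ≈ 1#
    +-monoˡ  : ∀ x y z → x ≤ y → x + z ≤ y + z
    *-nonNeg : ∀ x y → 0# ≤ x → 0# ≤ y → 0# ≤ x * y
    supremum : (P : Pred Carrier ℓ) → ∃ P → ∃ (UpperBound P) →
               ∃[ s ] (UpperBound P s × (∀ u → UpperBound P u → s ≤ u))

  commutativeRing : CommutativeRing ℓ ℓ
  commutativeRing = record { isCommutativeRing = isCommutativeRing }

  open CommutativeRing commutativeRing public using (_-_)
  open ToStrict _≈_ _≤_ public using () renaming (_<_ to infix 4 _<_)

  fromℕ : ℕ → Carrier
  fromℕ n = n ·ℕ 1#
    where
    open RawMonoidDefs (CommutativeRing.+-rawMonoid commutativeRing)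
      using () renaming (_×_ to _·ℕ_)

-- Excluded middle is used to define partial operations (division, square
-- root, sum of a series) as total functions, with the value 0 outside their
-- domain of definition.
module Analysis {ℓ : Level} (em : ExcludedMiddle ℓ)
                (R : CompleteOrderedField ℓ) where

  open CompleteOrderedField R
    using (_≈_; _≉_; _≤_; _<_; _+_; _*_; _-_; -_; 0#; 1#; inverse)
    renaming (Carrier to ℝ)

  infixl 7 _/_
  infix  9 _²

  _² : ℝ → ℝ
  x ² = x * x

  _/_ : ℝ → ℝ → ℝ
  x / y with em {y ≈ 0#}
  ... | yes _   = 0#
  ... | no  y≉0 = x * proj₁ (inverse y y≉0)

  -- The nonnegative square root; by completeness it exists whenever 0 ≤ x.
  √ : ℝ → ℝ
  √ x with em {∃[ r ] (0# ≤ r × r ² ≈ x)}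
  ... | yes (r , _) = r
  ... | no  _       = 0#

  infix  4 _≈ᶜ_ _≉ᶜ_
  infixl 7 _*ᶜ_

  record ℂ : Set ℓ where
    constructor _+i_
    field
      re : ℝ
      im : ℝ
  open ℂ public

  _≈ᶜ_ : Rel ℂ ℓ
  z ≈ᶜ u = re z ≈ re u × im z ≈ im u

  _≉ᶜ_ : Rel ℂ ℓ
  z ≉ᶜ u = ¬ (z ≈ᶜ u)

  0ᶜ : ℂ
  0ᶜ = 0# +i 0#

  _*ᶜ_ : ℂ → ℂ → ℂ
  z *ᶜ u = (re z * re u - im z * im u) +i (re z * im u + im z * re u)

  conj : ℂ → ℂ
  conj z = re z +i (- im z)

  ∣_∣ : ℂ → ℝ
  ∣ z ∣ = √ (re z ² + im z ²)

  module _ {G : Set ℓ} where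

    finiteSum : (G → ℝ) → List G → ℝ
    finiteSum f xs = foldr _+_ 0# (map f xs)

    -- Unconditional convergence of ∑_{π ∈ G} f(π): the finite partial sums
    -- converge along the finite subsets of G (lists without repetitions)
    -- directed by inclusion.
    HasSum : (G → ℝ) → ℝ → Set ℓ
    HasSum f s =
      ∀ ε → 0# < ε →
      ∃[ xs ] (Unique xs ×
               (∀ ys → Unique ys → xs ⊆ ys →
                 s - ε < finiteSum f ys × finiteSum f ys < s + ε))

    Converges : (G → ℝ) → Set ℓ
    Converges f = ∃[ s ] HasSum f s

    ∑ : (G → ℝ) → ℝ
    ∑ f with em {Converges f}
    ... | yes (s , _) = s
    ... | no  _       = 0#

  module Weighted {G : Set ℓ} (L : G → ℂ) (w : G → ℝ) where

    -- Since w is real, real and imaginary parts are averaged separately.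
    𝔼 : (G → ℂ) → ℂ
    𝔼 f = (∑ (λ π → w π * re (f π)) / ∑ w)
       +i (∑ (λ π → w π * im (f π)) / ∑ w)

    Ψ : (G → ℂ) → ℂ
    Ψ M = 𝔼 (λ π → L π *ᶜ M π)

    Ψ₂ : (G → ℂ) → (G → ℂ) → ℂ
    Ψ₂ M N = 𝔼 (λ π → (L π *ᶜ M π) *ᶜ conj (L π *ᶜ N π))

    -- Ψ₂ M M is an average of |L(π)M(π)|², hence real; its real part is that
    -- real number.
    β : (G → ℂ) → ℝ
    β M with em {Ψ₂ M M ≈ᶜ 0ᶜ}
    ... | yes _ = 0#
    ... | no  _ = ∣ Ψ M ∣ ² / re (Ψ₂ M M)

{-# OPTIONS --safe #-}
module Submission where

-- By Cauchy–Schwarz, |Ψ_{M,N}|² ≤ Ψ_{M,M} Ψ_{N,N}, so squaring the hypothesis gives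
-- (1 − δ)² |Ψ_N|² Ψ_{M,M} ≤ |Ψ_M|² Ψ_{N,N}, that is (1 − δ)² β(N) ≤ β(M); and
-- (1 + 4δ)(1 − δ)² ≥ 1 for 0 ≤ δ ≤ 1/10.

open import Defs
open import Level using (Level)
open import Axiom.ExcludedMiddle using (ExcludedMiddle)
open import Relation.Nullary.Negation.Core using (¬_; contradiction)
open import Algebra.Bundles using (CommutativeRing)
open import Data.Integer.Base as ℤ using (ℤ; +_; -[1+_]; _⊖_)
open import Data.List.Base using (List; []; _∷_; _++_; deduplicate)
open import Data.List.Membership.Propositional.Properties using (∈-deduplicate⁺; ∈-++⁺ˡ; ∈-++⁺ʳ)
open import Data.List.Relation.Unary.AllPairs using ([])
open import Data.Nat.Base as ℕ using (ℕ; zero; suc)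
open import Data.Product.Base using (∃-syntax; _×_; _,_; proj₁; proj₂)
open import Data.Sum.Base using (inj₁; inj₂)
open import Function.Base using (_∘_)
open import Relation.Binary.Definitions using (DecidableEquality)
open import Relation.Binary.Structures using (IsTotalOrder)
open import Relation.Nullary.Decidable.Core using (Dec; yes; no; dec⇒maybe)
import Algebra.Properties.AbelianGroup
import Algebra.Properties.Ring
import Algebra.Properties.Semiring.Mult.TCOptimised
import Algebra.Solver.Ring
import Algebra.Solver.Ring.AlmostCommutativeRing as ACR
import Data.Integer.Properties as ℤ
import Data.List.Relation.Unary.Unique.DecPropositional.Properties as DecUnique
open import Data.Maybe.Base as Maybe using (Maybe)
import Data.Nat.Properties as ℕ
import Relation.Binary.PropositionalEquality as ≡
import Relation.Binary.Reasoning.Setoid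

-- The image of the integers in a commutative ring.

-- Equality in the field does not compute, so the ring solver gets its coefficients from ℤ.
module IntegerCoefficients {c ℓ} (R : CommutativeRing c ℓ) where
  open CommutativeRing R
  open Algebra.Properties.Ring ring
    using (-‿distribˡ-*; -‿distribʳ-*; -‿involutive; -0#≈0#)
  open Algebra.Properties.AbelianGroup +-abelianGroup using (⁻¹-∙-comm)
  open Algebra.Properties.Semiring.Mult.TCOptimised semiring
    using (×-homo-+; 1+×; ×1-homo-*) renaming (_×_ to _·_)
  open Relation.Binary.Reasoning.Setoid setoid

  fromℤ : ℤ → Carrier
  fromℤ (+ n)    = n · 1#
  fromℤ -[1+ n ] = - (suc n · 1#)

  -- Cancelling a common successor corresponds to inserting `1# - 1#` between the two multiples,
  -- after which each of them absorbs one unit.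
  fromℤ-⊖ : ∀ m n → fromℤ (m ⊖ n) ≈ m · 1# - n · 1#
  fromℤ-⊖ m zero = begin
    m · 1#         ≈⟨ +-identityʳ _ ⟨
    m · 1# + 0#    ≈⟨ +-congˡ -0#≈0# ⟨
    m · 1# - 0#    ∎
  fromℤ-⊖ zero    (suc n) = sym (+-identityˡ _)
  fromℤ-⊖ (suc m) (suc n) = begin
    fromℤ (suc m ⊖ suc n)                ≡⟨ ≡.cong fromℤ (ℤ.[1+m]⊖[1+n]≡m⊖n m n) ⟩
    fromℤ (m ⊖ n)                        ≈⟨ fromℤ-⊖ m n ⟩
    m · 1# - n · 1#                      ≈⟨ +-congˡ (+-identityˡ _) ⟨
    m · 1# + (0# - n · 1#)               ≈⟨ +-congˡ (+-congʳ (-‿inverseʳ 1#)) ⟨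
    m · 1# + (1# - 1# - n · 1#)          ≈⟨ +-congˡ (+-assoc _ _ _) ⟩
    m · 1# + (1# + (- 1# - n · 1#))      ≈⟨ +-assoc _ _ _ ⟨
    m · 1# + 1# + (- 1# - n · 1#)        ≈⟨ +-cong (+-comm _ _) (⁻¹-∙-comm _ _) ⟩
    1# + m · 1# - (1# + n · 1#)          ≈⟨ +-cong (1+× m 1#) (-‿cong (1+× n 1#)) ⟨
    suc m · 1# - suc n · 1#              ∎

  fromℤ-+ : ∀ i j → fromℤ (i ℤ.+ j) ≈ fromℤ i + fromℤ j
  fromℤ-+ (+ m)    (+ n)    = ×-homo-+ 1# m n
  fromℤ-+ (+ m)    -[1+ n ] = fromℤ-⊖ m (suc n)
  fromℤ-+ -[1+ m ] (+ n)    = trans (fromℤ-⊖ n (suc m)) (+-comm _ _)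
  fromℤ-+ -[1+ m ] -[1+ n ] = begin
    -- `-[1+ m ]` is -(m + 1), so the sum of two such integers carries the successor twice; one copy
    -- has to move onto `n`.
    - (suc (suc (m ℕ.+ n)) · 1#)         ≡⟨ ≡.cong (λ k → - (k · 1#)) (ℕ.+-suc (suc m) n) ⟨
    - ((suc m ℕ.+ suc n) · 1#)           ≈⟨ -‿cong (×-homo-+ 1# (suc m) (suc n)) ⟩
    - (suc m · 1# + suc n · 1#)          ≈⟨ ⁻¹-∙-comm _ _ ⟨
    - (suc m · 1#) - suc n · 1#          ∎

  fromℤ-neg : ∀ i → fromℤ (ℤ.- i) ≈ - fromℤ i
  fromℤ-neg (+ zero)  = sym -0#≈0#
  fromℤ-neg (+ suc n) = refl
  fromℤ-neg -[1+ n ]  = sym (-‿involutive _)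

  fromℤ-pos-* : ∀ m n → fromℤ (+ m ℤ.* + n) ≈ fromℤ (+ m) * fromℤ (+ n)
  fromℤ-pos-* m n = begin
    fromℤ (+ m ℤ.* + n)  ≡⟨ ≡.cong fromℤ (ℤ.pos-* m n) ⟨
    (m ℕ.* n) · 1#       ≈⟨ ×1-homo-* m n ⟩
    m · 1# * (n · 1#)    ∎

  fromℤ-*-pos : ∀ i n → fromℤ (i ℤ.* + n) ≈ fromℤ i * fromℤ (+ n)
  fromℤ-*-pos (+ m)    n = fromℤ-pos-* m n
  fromℤ-*-pos -[1+ m ] n = begin
    fromℤ (-[1+ m ] ℤ.* + n)        ≡⟨ ≡.cong fromℤ (ℤ.neg-distribˡ-* (+ suc m) (+ n)) ⟨
    fromℤ (ℤ.- (+ suc m ℤ.* + n))   ≈⟨ fromℤ-neg (+ suc m ℤ.* + n) ⟩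
    - fromℤ (+ suc m ℤ.* + n)       ≈⟨ -‿cong (fromℤ-pos-* (suc m) n) ⟩
    - (suc m · 1# * (n · 1#))       ≈⟨ -‿distribˡ-* _ _ ⟩
    - (suc m · 1#) * (n · 1#)       ∎

  fromℤ-* : ∀ i j → fromℤ (i ℤ.* j) ≈ fromℤ i * fromℤ j
  fromℤ-* i (+ n)    = fromℤ-*-pos i n
  fromℤ-* i -[1+ n ] = begin
    fromℤ (i ℤ.* -[1+ n ])          ≡⟨ ≡.cong fromℤ (ℤ.neg-distribʳ-* i (+ suc n)) ⟨
    fromℤ (ℤ.- (i ℤ.* + suc n))     ≈⟨ fromℤ-neg (i ℤ.* + suc n) ⟩
    - fromℤ (i ℤ.* + suc n)         ≈⟨ -‿cong (fromℤ-*-pos i (suc n)) ⟩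
    - (fromℤ i * (suc n · 1#))      ≈⟨ -‿distribʳ-* _ _ ⟩
    fromℤ i * - (suc n · 1#)        ∎

  fromℤ-morphism : ℤ.+-*-rawRing ACR.-Raw-AlmostCommutative⟶ ACR.fromCommutativeRing R
  fromℤ-morphism = record
    { ⟦_⟧    = fromℤ
    ; +-homo = fromℤ-+
    ; *-homo = fromℤ-*
    ; -‿homo = fromℤ-neg
    ; 0-homo = refl
    ; 1-homo = refl
    }

  -- The solver only needs a sound test: equal integers have equal images, and `nothing` claims
  -- nothing about distinct ones.
  fromℤ-≟ : ∀ i j → Maybe (fromℤ i ≈ fromℤ j)
  fromℤ-≟ i j = Maybe.map (λ i≡j → reflexive (≡.cong fromℤ i≡j)) (dec⇒maybe (i ℤ.≟ j))

  open Algebra.Solver.Ring ℤ.+-*-rawRing (ACR.fromCommutativeRing R) fromℤ-morphism fromℤ-≟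
    public using (Polynomial; solve; con; _:=_; _:+_; _:*_; _:-_; :-_)

  :1 : ∀ {n} → Polynomial n
  :1 = con (+ 1)

  -- Repeats the recursion of `fromℕ`, so that the polynomial evaluates to a `fromℕ` value by
  -- computation; `con` would give a sum of another shape.
  :fromℕ : ∀ {n} → ℕ → Polynomial n
  :fromℕ zero    = con (+ 0)
  :fromℕ (suc k) = :1 :+ :fromℕ k

-- Order and arithmetic in a complete ordered field.

module OrderedField {ℓ : Level} (em : ExcludedMiddle ℓ) (R : CompleteOrderedField ℓ) where
  open CompleteOrderedField R public renaming (Carrier to ℝ)
  open CommutativeRing commutativeRing public
    using (refl; sym; trans; setoid; +-cong; +-congˡ; +-congʳ; *-cong; *-congˡ; *-congʳ;
           -‿cong; +-identityˡ; *-identityˡ; *-identityʳ; *-comm; zeroˡ; zeroʳ; -‿inverseʳ)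
  open IsTotalOrder isTotalOrder public
    using (total; antisym; ≤-respˡ-≈; ≤-respʳ-≈)
    renaming (refl to ≤-refl; trans to ≤-trans; reflexive to ≤-reflexive)
  open IntegerCoefficients commutativeRing public
  open Relation.Binary.Reasoning.Setoid setoid

  private variable
    x y z e : ℝ

  ≤-resp-≈ : ∀ {x x′ y y′} → x ≈ x′ → y ≈ y′ → x ≤ y → x′ ≤ y′
  ≤-resp-≈ x≈x′ y≈y′ x≤y = ≤-respˡ-≈ x≈x′ (≤-respʳ-≈ y≈y′ x≤y)

  x≤y⇒0≤y-x : x ≤ y → 0# ≤ y - x
  x≤y⇒0≤y-x {x} {y} x≤y = ≤-respˡ-≈ (-‿inverseʳ x) (+-monoˡ x y (- x) x≤y)

  -- Reduces an estimate to an explicit nonnegative remainder and a ring identity that the solver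
  -- can check. Many inequalities below are proved in this form.
  ≤-byDifference : 0# ≤ e → y ≈ x + e → x ≤ y
  ≤-byDifference {e} {y} {x} 0≤e y≈x+e = ≤-resp-≈
    (+-identityˡ x)
    (trans (solve 2 (λ e x → e :+ x := x :+ e) refl e x) (sym y≈x+e))
    (+-monoˡ 0# e x 0≤e)

  0≤y-x⇒x≤y : 0# ≤ y - x → x ≤ y
  0≤y-x⇒x≤y {y} {x} 0≤y-x =
    ≤-byDifference 0≤y-x (solve 2 (λ x y → y := x :+ (y :- x)) refl x y)

  x≤0⇒0≤-x : x ≤ 0# → 0# ≤ - x
  x≤0⇒0≤-x {x} x≤0 = ≤-respʳ-≈ (+-identityˡ (- x)) (x≤y⇒0≤y-x x≤0)

  +-nonNeg : 0# ≤ x → 0# ≤ y → 0# ≤ x + y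
  +-nonNeg {x} {y} 0≤x 0≤y = ≤-trans 0≤x (≤-byDifference 0≤y refl)

  x*x-nonNeg : ∀ x → 0# ≤ x * x
  x*x-nonNeg x with total 0# x
  ... | inj₁ 0≤x = *-nonNeg x x 0≤x 0≤x
  ... | inj₂ x≤0 = ≤-respʳ-≈ (solve 1 (λ x → :- x :* :- x := x :* x) refl x)
                     (*-nonNeg (- x) (- x) (x≤0⇒0≤-x x≤0) (x≤0⇒0≤-x x≤0))

  0≤1 : 0# ≤ 1#
  0≤1 = ≤-respʳ-≈ (*-identityˡ 1#) (x*x-nonNeg 1#)

  fromℕ-nonNeg : ∀ n → 0# ≤ fromℕ n
  fromℕ-nonNeg zero    = ≤-refl
  fromℕ-nonNeg (suc n) = +-nonNeg 0≤1 (fromℕ-nonNeg n)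

  *-monoˡ-≤ : 0# ≤ z → x ≤ y → x * z ≤ y * z
  *-monoˡ-≤ {z} {x} {y} 0≤z x≤y =
    ≤-byDifference (*-nonNeg (y - x) z (x≤y⇒0≤y-x x≤y) 0≤z)
      (solve 3 (λ x y z → y :* z := x :* z :+ (y :- x) :* z) refl x y z)

  *-monoʳ-≤ : 0# ≤ z → x ≤ y → z * x ≤ z * y
  *-monoʳ-≤ 0≤z x≤y = ≤-resp-≈ (*-comm _ _) (*-comm _ _) (*-monoˡ-≤ 0≤z x≤y)

  *-mono-square : 0# ≤ x → x ≤ y → x * x ≤ y * y
  *-mono-square 0≤x x≤y =
    ≤-trans (*-monoˡ-≤ 0≤x x≤y) (*-monoʳ-≤ (≤-trans 0≤x x≤y) x≤y)

  -- `y` equals `x * (y * y)`, a product of nonnegative factors.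
  inverse-nonNeg : 0# ≤ x → x * y ≈ 1# → 0# ≤ y
  inverse-nonNeg {x} {y} 0≤x xy≈1 = ≤-respʳ-≈
    (begin
      x * (y * y)  ≈⟨ solve 2 (λ x y → x :* (y :* y) := x :* y :* y) refl x y ⟩
      x * y * y    ≈⟨ *-congʳ xy≈1 ⟩
      1# * y       ≈⟨ *-identityˡ y ⟩
      y            ∎)
    (*-nonNeg x (y * y) 0≤x (x*x-nonNeg y))

  *-cancelʳ-≤ : 0# < z → x * z ≤ y * z → x ≤ y
  *-cancelʳ-≤ {z} {x} {y} (0≤z , 0≉z) xz≤yz =
    let i , zi≈1 = inverse z (λ z≈0 → 0≉z (sym z≈0))
        cancel : ∀ x → x * z * i ≈ x
        cancel x = begin
          x * z * i    ≈⟨ solve 3 (λ x z i → x :* z :* i := x :* (z :* i)) refl x z i ⟩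
          x * (z * i)  ≈⟨ *-congˡ zi≈1 ⟩
          x * 1#       ≈⟨ *-identityʳ x ⟩
          x            ∎
    in ≤-resp-≈ (cancel x) (cancel y) (*-monoˡ-≤ (inverse-nonNeg 0≤z zi≈1) xz≤yz)

  <-resp-0 : x ≈ y → 0# < x → 0# < y
  <-resp-0 x≈y (0≤x , 0≉x) = ≤-respʳ-≈ x≈y 0≤x , λ 0≈y → 0≉x (trans 0≈y (sym x≈y))

  0<x≤y⇒0<y : 0# < x → x ≤ y → 0# < y
  0<x≤y⇒0<y (0≤x , 0≉x) x≤y =
    ≤-trans 0≤x x≤y , λ 0≈y → 0≉x (antisym 0≤x (≤-respʳ-≈ (sym 0≈y) x≤y))

  +-pos : 0# < x → 0# ≤ y → 0# < x + y
  +-pos 0<x 0≤y = 0<x≤y⇒0<y 0<x (≤-byDifference 0≤y refl)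

  *-pos : 0# < x → 0# < y → 0# < x * y
  *-pos {x} {y} (0≤x , 0≉x) 0<y@(0≤y , _) = *-nonNeg x y 0≤x 0≤y , λ 0≈xy →
    0≉x (antisym 0≤x (*-cancelʳ-≤ 0<y
      (≤-reflexive (trans (sym 0≈xy) (sym (zeroˡ y))))))

  inverse-pos : 0# < x → x * y ≈ 1# → 0# < y
  inverse-pos {x} (0≤x , _) xy≈1 = inverse-nonNeg 0≤x xy≈1 , λ 0≈y →
    0≉1 (trans (sym (zeroʳ x)) (trans (*-congˡ 0≈y) xy≈1))

  0<1 : 0# < 1#
  0<1 = 0≤1 , 0≉1

  0<2 : 0# < 1# + 1#
  0<2 = +-pos 0<1 0≤1

  x<y⇒0<y-x : x < y → 0# < y - x
  x<y⇒0<y-x {x} {y} (x≤y , x≉y) = x≤y⇒0≤y-x x≤y , λ 0≈y-x → x≉y (begin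
    x            ≈⟨ solve 1 (λ x → x := x :+ con (+ 0)) refl x ⟩
    x + 0#       ≈⟨ +-congˡ 0≈y-x ⟩
    x + (y - x)  ≈⟨ solve 2 (λ x y → x :+ (y :- x) := y) refl x y ⟩
    y            ∎)

  <-byDifference : 0# < e → y ≈ x + e → x < y
  <-byDifference {e} {y} {x} (0≤e , 0≉e) y≈x+e = ≤-byDifference 0≤e y≈x+e , λ x≈y → 0≉e (begin
    0#         ≈⟨ -‿inverseʳ y ⟨
    y - y      ≈⟨ +-cong y≈x+e (-‿cong (sym x≈y)) ⟩
    x + e - x  ≈⟨ solve 2 (λ x e → x :+ e :- x := e) refl x e ⟩
    e          ∎)

  -- The quotient is specified by its equation alone. Newton's iterates and the tolerances ε / 2 and
  -- ε / c of the summation lemmas are obtained from it.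
  positive-quotient : 0# < x → 0# < y → ∃[ z ] (0# < z × x * z ≈ y)
  positive-quotient {x} {y} 0<x@(_ , 0≉x) 0<y =
    let i , xi≈1 = inverse x (λ x≈0 → 0≉x (sym x≈0)) in
    i * y , *-pos (inverse-pos 0<x xi≈1) 0<y , (begin
      x * (i * y)  ≈⟨ solve 3 (λ x i y → x :* (i :* y) := x :* i :* y) refl x i y ⟩
      x * i * y    ≈⟨ *-congʳ xi≈1 ⟩
      1# * y       ≈⟨ *-identityˡ y ⟩
      y            ∎)

  -- In the case y < x, the sum x + y is positive, and y² - x² = (y - x)(y + x) allows it to be
  -- cancelled.
  *-cancel-square-≤ : 0# ≤ y → x * x ≤ y * y → x ≤ y
  *-cancel-square-≤ {y} {x} 0≤y xx≤yy with total x y | em {x ≈ y}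
  ... | inj₁ x≤y | _       = x≤y
  ... | inj₂ _   | yes x≈y = ≤-reflexive x≈y
  ... | inj₂ y≤x | no  x≉y = *-cancelʳ-≤ {z = x + y} 0<x+y
    (≤-byDifference (x≤y⇒0≤y-x xx≤yy)
      (solve 2 (λ x y → y :* (x :+ y) := x :* (x :+ y) :+ (y :* y :- x :* x)) refl x y))
    where
    0<x+y : 0# < x + y
    0<x+y = 0<x≤y⇒0<y (x<y⇒0<y-x (y≤x , λ y≈x → x≉y (sym y≈x)))
      (≤-byDifference (+-nonNeg 0≤y 0≤y)
        (solve 2 (λ x y → x :+ y := x :- y :+ (y :+ y)) refl x y))

  -- Existence of square roots.

  -- For s > 0, Newton's iterate u = (s² + x) / 2s bounds {r ≥ 0 : r² ≤ x} from above, and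
  -- x / u belongs to this set. For s its supremum, x / u ≤ s ≤ u, whence x ≤ s² ≤ x.
  module _ (x : ℝ) (0<x : 0# < x) where
    private
      0≤x : 0# ≤ x
      0≤x = proj₁ 0<x

      Below : ℝ → Set ℓ
      Below r = 0# ≤ r × r * r ≤ x

    module _ (s : ℝ) (0<s : 0# < s) where
      private
        0≤s : 0# ≤ s
        0≤s = proj₁ 0<s

        0<s²+x : 0# < s * s + x
        0<s²+x = +-pos (*-pos 0<s 0<s) 0≤x

        0<s+s : 0# < s + s
        0<s+s = +-pos 0<s 0≤s

        iterate : ∃[ u ] (0# < u × (s + s) * u ≈ s * s + x)
        iterate = positive-quotient 0<s+s 0<s²+x

        -- The value `r` is `x / u` for the iterate `u`, obtained without dividing by `u`.
        dual : ∃[ r ] (0# < r × (s * s + x) * r ≈ (s + s) * x)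
        dual = positive-quotient 0<s²+x (*-pos 0<s+s 0<x)

        square : y ≈ z → y * y ≈ z * z
        square y≈z = *-cong y≈z y≈z

      upper : ∃[ u ] ((∀ r → Below r → r ≤ u) × (s ≤ u → s * s ≤ x))
      upper = let u , 0<u , su≈ = iterate in
        u
        , (λ r (_ , rr≤x) → *-cancel-square-≤ (proj₁ 0<u) (≤-trans rr≤x
            -- Multiplied by (2s)², the claim x ≤ u² has the remainder (s² - x)²; this is the
            -- inequality of arithmetic and geometric means for s and x / s.
            (*-cancelʳ-≤ (*-pos 0<s+s 0<s+s)
              (≤-byDifference (x*x-nonNeg (s * s - x)) (begin
                u * u * ((s + s) * (s + s))
                  ≈⟨ solve 2 (λ u s → u :* u :* ((s :+ s) :* (s :+ s)) :=
                                      (s :+ s) :* u :* ((s :+ s) :* u)) refl u s ⟩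
                (s + s) * u * ((s + s) * u)
                  ≈⟨ square su≈ ⟩
                (s * s + x) * (s * s + x)
                  ≈⟨ solve 2 (λ s x → (s :* s :+ x) :* (s :* s :+ x) :=
                       x :* ((s :+ s) :* (s :+ s)) :+ (s :* s :- x) :* (s :* s :- x)) refl s x ⟩
                x * ((s + s) * (s + s)) + (s * s - x) * (s * s - x)
                  ∎)))))
        -- s ≤ u gives 2s² ≤ 2su = s² + x.
        , (λ s≤u → 0≤y-x⇒x≤y (≤-respʳ-≈
            (begin
              (s + s) * u - (s + s) * s
                ≈⟨ +-congʳ su≈ ⟩
              s * s + x - (s + s) * s
                ≈⟨ solve 2 (λ s x → s :* s :+ x :- (s :+ s) :* s := x :- s :* s) refl s x ⟩
              x - s * s
                ∎)
            (x≤y⇒0≤y-x (*-monoʳ-≤ (proj₁ 0<s+s) s≤u))))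

      lower : ∃[ r ] (0# < r × Below r × (r ≤ s → x ≤ s * s))
      lower = let r , 0<r , sr≈ = dual in
        r
        , 0<r
        , (proj₁ 0<r
          -- Both sides are multiplied by (s² + x)²; the remainder is x (s² - x)².
          , *-cancelʳ-≤ (*-pos 0<s²+x 0<s²+x)
              (≤-byDifference (*-nonNeg _ _ 0≤x (x*x-nonNeg (s * s - x))) (begin
                x * ((s * s + x) * (s * s + x))
                  ≈⟨ solve 2 (λ s x → x :* ((s :* s :+ x) :* (s :* s :+ x)) :=
                       (s :+ s) :* x :* ((s :+ s) :* x)
                         :+ x :* ((s :* s :- x) :* (s :* s :- x))) refl s x ⟩
                (s + s) * x * ((s + s) * x) + x * ((s * s - x) * (s * s - x))
                  ≈⟨ +-congʳ (square sr≈) ⟨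
                (s * s + x) * r * ((s * s + x) * r) + x * ((s * s - x) * (s * s - x))
                  ≈⟨ +-congʳ (solve 2 (λ r k → k :* r :* (k :* r) := r :* r :* (k :* k))
                       refl r (s * s + x)) ⟩
                r * r * ((s * s + x) * (s * s + x)) + x * ((s * s - x) * (s * s - x))
                  ∎)))
        -- r ≤ s gives 2sx = (s² + x) r ≤ (s² + x) s, that is xs ≤ s³, and s is cancelled.
        , (λ r≤s → *-cancelʳ-≤ 0<s (0≤y-x⇒x≤y (≤-respʳ-≈
            (begin
              (s * s + x) * s - (s * s + x) * r
                ≈⟨ +-congˡ (-‿cong sr≈) ⟩
              (s * s + x) * s - (s + s) * x
                ≈⟨ solve 2 (λ s x → (s :* s :+ x) :* s :- (s :+ s) :* x :=
                                    s :* s :* s :- x :* s) refl s x ⟩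
              s * s * s - x * s
                ∎)
            (x≤y⇒0≤y-x (*-monoʳ-≤ (proj₁ 0<s²+x) r≤s)))))

    sqrt-pos-exists : ∃[ r ] (0# ≤ r × r * r ≈ x)
    sqrt-pos-exists =
      -- The value s = 1 is a starting point: it shows the set nonempty and bounded, and the
      -- positive member `r₁` makes the supremum positive, as `upper` and `lower` require.
      let r₁ , 0<r₁ , below-r₁ , _ = lower 1# 0<1
          u₁ , bound-u₁ , _       = upper 1# 0<1
          s , bound-s , least-s   = supremum Below (r₁ , below-r₁) (u₁ , bound-u₁)
          0<s                     = 0<x≤y⇒0<y 0<r₁ (bound-s r₁ below-r₁)
          u , bound-u , s≤u⇒      = upper s 0<s
          r , _ , below-r , r≤s⇒  = lower s 0<s
      in s , proj₁ 0<s , antisym (s≤u⇒ (least-s u bound-u)) (r≤s⇒ (bound-s r below-r))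

  sqrt-exists : ∀ x → 0# ≤ x → ∃[ r ] (0# ≤ r × r * r ≈ x)
  sqrt-exists x 0≤x with em {x ≈ 0#}
  ... | yes x≈0 = 0# , ≤-refl , trans (zeroˡ 0#) (sym x≈0)
  ... | no  x≉0 = sqrt-pos-exists x (0≤x , λ 0≈x → x≉0 (sym 0≈x))

-- Moduli and total division.

module Sums {ℓ : Level} (em : ExcludedMiddle ℓ) (R : CompleteOrderedField ℓ) where
  open OrderedField em R
  open Analysis em R
  open Relation.Binary.Reasoning.Setoid setoid

  √-square : ∀ {x} → 0# ≤ x → √ x ² ≈ x
  √-square {x} 0≤x with em {∃[ r ] (0# ≤ r × r ² ≈ x)}
  ... | yes (_ , _ , r²≈x) = r²≈x
  ... | no  ∄r             = contradiction (sqrt-exists x 0≤x) ∄r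

  √-nonNeg : ∀ x → 0# ≤ √ x
  √-nonNeg x with em {∃[ r ] (0# ≤ r × r ² ≈ x)}
  ... | yes (_ , 0≤r , _) = 0≤r
  ... | no  _             = ≤-refl

  ∣∣²≈ : ∀ z → ∣ z ∣ ² ≈ re z ² + im z ²
  ∣∣²≈ z = √-square (+-nonNeg (x*x-nonNeg (re z)) (x*x-nonNeg (im z)))

  -- The two-square identity, stated for squared moduli because `√` is accessible only through its
  -- square and its sign.
  ∣∣²-*ᶜ : ∀ z u → ∣ z *ᶜ u ∣ ² ≈ ∣ z ∣ ² * ∣ u ∣ ²
  ∣∣²-*ᶜ z@(a +i b) u@(c +i d) = begin
    ∣ z *ᶜ u ∣ ²
      ≈⟨ ∣∣²≈ (z *ᶜ u) ⟩
    (a * c - b * d) ² + (a * d + b * c) ²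
      ≈⟨ solve 4 (λ a b c d →
           (a :* c :- b :* d) :* (a :* c :- b :* d) :+ (a :* d :+ b :* c) :* (a :* d :+ b :* c)
             := (a :* a :+ b :* b) :* (c :* c :+ d :* d)) refl a b c d ⟩
    (a ² + b ²) * (c ² + d ²)
      ≈⟨ *-cong (∣∣²≈ z) (∣∣²≈ u) ⟨
    ∣ z ∣ ² * ∣ u ∣ ²
      ∎

  re-*-conj : ∀ z → re (z *ᶜ conj z) ≈ ∣ z ∣ ²
  re-*-conj z = trans
    (solve 2 (λ a b → a :* a :- b :* (:- b) := a :* a :+ b :* b) refl (re z) (im z))
    (sym (∣∣²≈ z))

  im-*-conj : ∀ z → im (z *ᶜ conj z) ≈ 0#
  im-*-conj z =
    solve 2 (λ a b → a :* (:- b) :+ b :* a := con (+ 0)) refl (re z) (im z)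

  -- For `y ≈ 0#` both sides have the default value 0. Averages can thus be handled as products with
  -- the fixed scalar `1# / ∑ w`.
  x/y≈x*1/y : ∀ x y → x / y ≈ x * (1# / y)
  x/y≈x*1/y x y with em {y ≈ 0#}
  ... | yes _ = sym (zeroʳ x)
  ... | no  _ = *-congˡ (sym (*-identityˡ _))

  x/y*y≈x : ∀ x {y} → y ≉ 0# → x / y * y ≈ x
  x/y*y≈x x {y} y≉0 with em {y ≈ 0#}
  ... | yes y≈0  = contradiction y≈0 y≉0
  ... | no  y≉0′ = let i , yi≈1 = inverse y y≉0′ in begin
    x * i * y    ≈⟨ solve 3 (λ x i y → x :* i :* y := x :* (y :* i)) refl x i y ⟩
    x * (y * i)  ≈⟨ *-congˡ yi≈1 ⟩
    x * 1#       ≈⟨ *-identityʳ x ⟩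
    x            ∎

  1/-nonNeg : ∀ {y} → 0# ≤ y → 0# ≤ 1# / y
  1/-nonNeg {y} 0≤y with em {y ≈ 0#}
  ... | yes _   = ≤-refl
  ... | no  y≉0 = let i , yi≈1 = inverse y y≉0 in
    ≤-respʳ-≈ (sym (*-identityˡ i)) (inverse-nonNeg 0≤y yi≈1)

  /-nonNeg : ∀ {x y} → 0# ≤ x → 0# ≤ y → 0# ≤ x / y
  /-nonNeg {x} {y} 0≤x 0≤y =
    ≤-respʳ-≈ (sym (x/y≈x*1/y x y)) (*-nonNeg x (1# / y) 0≤x (1/-nonNeg 0≤y))

  -- Turns the bound δ ≤ 1/10 into 10δ ≤ 1, the form that polynomial estimates use. For a zero `y`
  -- the product vanishes and the claim is 0 ≤ 1.
  x≤1/y⇒y*x≤1 : ∀ {x y} → 0# ≤ y → x ≤ 1# / y → y * x ≤ 1#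
  x≤1/y⇒y*x≤1 {x} {y} 0≤y x≤1/y with em {y ≈ 0#}
  ... | yes y≈0 = ≤-respˡ-≈ (sym (trans (*-congʳ y≈0) (zeroˡ x))) 0≤1
  ... | no  y≉0 = ≤-respʳ-≈ (trans (*-congˡ (*-identityˡ _)) (proj₂ (inverse y y≉0)))
                    (*-monoʳ-≤ 0≤y x≤1/y)

  -- Unconditional sums of real families.

  module _ {G : Set ℓ} where
    private variable
      f g : G → ℝ
      s t : ℝ

    finiteSum-cong : (∀ π → f π ≈ g π) → ∀ xs → finiteSum f xs ≈ finiteSum g xs
    finiteSum-cong f≈g []       = refl
    finiteSum-cong f≈g (π ∷ xs) = +-cong (f≈g π) (finiteSum-cong f≈g xs)

    finiteSum-+ : ∀ (f g : G → ℝ) xs →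
                  finiteSum (λ π → f π + g π) xs ≈ finiteSum f xs + finiteSum g xs
    finiteSum-+ f g []       = sym (+-identityˡ 0#)
    finiteSum-+ f g (π ∷ xs) = trans (+-congˡ (finiteSum-+ f g xs))
      (solve 4 (λ a b c d → a :+ b :+ (c :+ d) := a :+ c :+ (b :+ d)) refl _ _ _ _)

    finiteSum-* : ∀ c (f : G → ℝ) xs → finiteSum (λ π → c * f π) xs ≈ c * finiteSum f xs
    finiteSum-* c f []       = sym (zeroʳ c)
    finiteSum-* c f (π ∷ xs) = trans (+-congˡ (finiteSum-* c f xs))
      (solve 3 (λ c a b → c :* a :+ c :* b := c :* (a :+ b)) refl _ _ _)

    finiteSum-nonNeg : (∀ π → 0# ≤ f π) → ∀ xs → 0# ≤ finiteSum f xs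
    finiteSum-nonNeg 0≤f []       = ≤-refl
    finiteSum-nonNeg 0≤f (π ∷ xs) = +-nonNeg (0≤f π) (finiteSum-nonNeg 0≤f xs)

    _≟_ : DecidableEquality G
    x ≟ y = em

    -- `HasSum` ranges over lists without repetitions, so the concatenation has to be deduplicated,
    -- with equality on `G` decided by excluded middle.
    union : List G → List G → List G
    union xs ys = deduplicate _≟_ (xs ++ ys)

    hasSum-cong : (∀ π → f π ≈ g π) → s ≈ t → HasSum f s → HasSum g t
    hasSum-cong {f} {g} {s} {t} f≈g s≈t f-s ε 0<ε =
      let xs , xs! , near = f-s ε 0<ε in
      xs , xs! , λ ys ys! xs⊆ys →
      let below , above = near ys ys! xs⊆ys
          Σ≈            = finiteSum-cong f≈g ys
      in <-byDifference (x<y⇒0<y-x below) (begin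
           finiteSum g ys
             ≈⟨ Σ≈ ⟨
           finiteSum f ys
             ≈⟨ solve 3 (λ a s e → a := s :- e :+ (a :- (s :- e))) refl _ s ε ⟩
           s - ε + (finiteSum f ys - (s - ε))
             ≈⟨ +-congʳ (+-congʳ s≈t) ⟩
           t - ε + (finiteSum f ys - (s - ε))
             ∎)
       , <-byDifference (x<y⇒0<y-x above) (begin
           t + ε
             ≈⟨ +-congʳ s≈t ⟨
           s + ε
             ≈⟨ solve 3 (λ a s e → s :+ e := a :+ (s :+ e :- a)) refl (finiteSum f ys) s ε ⟩
           finiteSum f ys + (s + ε - finiteSum f ys)
             ≈⟨ +-congʳ Σ≈ ⟩
           finiteSum g ys + (s + ε - finiteSum f ys)
             ∎)

    hasSum-0 : HasSum {G} (λ _ → 0#) 0#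
    hasSum-0 ε 0<ε = [] , [] , λ ys _ _ →
      let Σ≈0 : finiteSum {G} (λ _ → 0#) ys ≈ 0#
          -- Reading 0 as 0 · 0 lets `finiteSum-*` evaluate the sum.
          Σ≈0 = trans (finiteSum-cong (λ _ → sym (zeroˡ 0#)) ys)
                  (trans (finiteSum-* 0# (λ _ → 0#) ys) (zeroˡ _))
      in <-byDifference 0<ε (trans Σ≈0
           (solve 1 (λ e → con (+ 0) := con (+ 0) :- e :+ e) refl ε))
       , <-byDifference 0<ε (+-congʳ (sym Σ≈0))

    hasSum-+ : HasSum f s → HasSum g t → HasSum (λ π → f π + g π) (s + t)
    hasSum-+ {f} {s} {g} {t} f-s g-t ε 0<ε =
      -- Each series gets the tolerance ε / 2, and the union of the two threshold sets serves for
      -- both.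
      let η , 0<η , 2η≈ε = positive-quotient 0<2 0<ε
          xs , _ , near-s   = f-s η 0<η
          ys , _ , near-t   = g-t η 0<η
      in union xs ys , DecUnique.deduplicate-! _≟_ (xs ++ ys) , λ zs zs! ∪⊆zs →
      let below-s , above-s =
            near-s zs zs! (λ z∈xs → ∪⊆zs (∈-deduplicate⁺ _≟_ (∈-++⁺ˡ z∈xs)))
          below-t , above-t =
            near-t zs zs! (λ z∈ys → ∪⊆zs (∈-deduplicate⁺ _≟_ (∈-++⁺ʳ xs z∈ys)))
          F = finiteSum f zs
          H = finiteSum g zs
      in <-byDifference (+-pos (x<y⇒0<y-x below-s) (proj₁ (x<y⇒0<y-x below-t))) (begin
           finiteSum (λ π → f π + g π) zs
             ≈⟨ finiteSum-+ f g zs ⟩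
           F + H
             ≈⟨ solve 5 (λ F H s t e → F :+ H :=
                  s :+ t :- (:1 :+ :1) :* e :+ (F :- (s :- e) :+ (H :- (t :- e))))
                  refl F H s t η ⟩
           s + t - (1# + 1#) * η + (F - (s - η) + (H - (t - η)))
             ≈⟨ +-congʳ (+-congˡ (-‿cong 2η≈ε)) ⟩
           s + t - ε + (F - (s - η) + (H - (t - η)))
             ∎)
       , <-byDifference (+-pos (x<y⇒0<y-x above-s) (proj₁ (x<y⇒0<y-x above-t))) (begin
           s + t + ε
             ≈⟨ +-congˡ 2η≈ε ⟨
           s + t + (1# + 1#) * η
             ≈⟨ solve 5 (λ F H s t e → s :+ t :+ (:1 :+ :1) :* e :=
                  F :+ H :+ (s :+ e :- F :+ (t :+ e :- H)))
                  refl F H s t η ⟩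
           F + H + (s + η - F + (t + η - H))
             ≈⟨ +-congʳ (finiteSum-+ f g zs) ⟨
           finiteSum (λ π → f π + g π) zs + (s + η - F + (t + η - H))
             ∎)

    hasSum-*-pos : ∀ {c} → 0# < c → HasSum f s → HasSum (λ π → c * f π) (c * s)
    hasSum-*-pos {f} {s} {c} 0<c f-s ε 0<ε =
      -- The tolerance for `f` is ε / c.
      let η , 0<η , cη≈ε = positive-quotient 0<c 0<ε
          xs , xs! , near = f-s η 0<η
      in xs , xs! , λ ys ys! xs⊆ys →
      let below , above = near ys ys! xs⊆ys
          F             = finiteSum f ys
      in <-byDifference (*-pos 0<c (x<y⇒0<y-x below)) (begin
           finiteSum (λ π → c * f π) ys
             ≈⟨ finiteSum-* c f ys ⟩
           c * F
             ≈⟨ solve 4 (λ c F s e → c :* F := c :* s :- c :* e :+ c :* (F :- (s :- e)))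
                  refl c F s η ⟩
           c * s - c * η + c * (F - (s - η))
             ≈⟨ +-congʳ (+-congˡ (-‿cong cη≈ε)) ⟩
           c * s - ε + c * (F - (s - η))
             ∎)
       , <-byDifference (*-pos 0<c (x<y⇒0<y-x above)) (begin
           c * s + ε
             ≈⟨ +-congˡ cη≈ε ⟨
           c * s + c * η
             ≈⟨ solve 4 (λ c F s e → c :* s :+ c :* e := c :* F :+ c :* (s :+ e :- F))
                  refl c F s η ⟩
           c * F + c * (s + η - F)
             ≈⟨ +-congʳ (finiteSum-* c f ys) ⟨
           finiteSum (λ π → c * f π) ys + c * (s + η - F)
             ∎)

    -- Negation exchanges the lower and the upper bound and keeps ε. It is written as a product with
    -- -1 so that `finiteSum-*` applies.
    hasSum-neg : HasSum f s → HasSum (λ π → - 1# * f π) (- 1# * s)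
    hasSum-neg {f} {s} f-s ε 0<ε =
      let xs , xs! , near = f-s ε 0<ε
      in xs , xs! , λ ys ys! xs⊆ys →
      let below , above = near ys ys! xs⊆ys
          F             = finiteSum f ys
      in <-byDifference (x<y⇒0<y-x above) (trans (finiteSum-* (- 1#) f ys)
           (solve 3 (λ F s e → :- :1 :* F := :- :1 :* s :- e :+ (s :+ e :- F)) refl F s ε))
       , <-byDifference (x<y⇒0<y-x below) (trans
           (solve 3 (λ F s e → :- :1 :* s :+ e := :- :1 :* F :+ (F :- (s :- e))) refl F s ε)
           (+-congʳ (sym (finiteSum-* (- 1#) f ys))))

    -- A zero factor gives the zero family, and a negative `c` is -1 times the positive `- c`.
    hasSum-* : ∀ c → HasSum f s → HasSum (λ π → c * f π) (c * s)
    hasSum-* {f} {s} c f-s with em {c ≈ 0#} | total 0# c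
    ... | yes c≈0 | _ =
      hasSum-cong (λ π → sym (trans (*-congʳ c≈0) (zeroˡ _)))
                  (sym (trans (*-congʳ c≈0) (zeroˡ _))) hasSum-0
    ... | no  c≉0 | inj₁ 0≤c = hasSum-*-pos (0≤c , c≉0 ∘ sym) f-s
    ... | no  c≉0 | inj₂ c≤0 = hasSum-cong (λ π → cancel (f π)) (cancel s)
      (hasSum-neg (hasSum-*-pos (<-resp-0 (+-identityˡ (- c)) (x<y⇒0<y-x (c≤0 , c≉0))) f-s))
      where
      cancel : ∀ x → - 1# * (- c * x) ≈ c * x
      cancel = solve 2 (λ c x → :- :1 :* (:- c :* x) := c :* x) refl c

    -- With tolerance `- s`, a negative `s` would force a partial sum strictly below 0.
    hasSum-nonNeg : (∀ π → 0# ≤ f π) → HasSum f s → 0# ≤ s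
    hasSum-nonNeg {f} {s} 0≤f f-s with total 0# s | em {s ≈ 0#}
    ... | inj₁ 0≤s | _       = 0≤s
    ... | inj₂ _   | yes s≈0 = ≤-reflexive (sym s≈0)
    ... | inj₂ s≤0 | no  s≉0 =
      let xs , xs! , near = f-s (- s) (<-resp-0 (+-identityˡ (- s)) (x<y⇒0<y-x (s≤0 , s≉0)))
          Σ≤ , Σ≉         = proj₂ (near xs xs! (λ x∈xs → x∈xs))
          Σ≤0             = ≤-respʳ-≈ (-‿inverseʳ s) Σ≤
          Σ≈0             = antisym Σ≤0 (finiteSum-nonNeg 0≤f xs)
      in contradiction (trans Σ≈0 (sym (-‿inverseʳ s))) Σ≉

    ∑-hasSum : Converges f → HasSum f (∑ f)
    ∑-hasSum {f} converges with em {Converges f}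
    ... | yes (_ , f-s) = f-s
    ... | no  diverges  = contradiction converges diverges

    ∑-nonNeg : (∀ π → 0# ≤ f π) → 0# ≤ ∑ f
    ∑-nonNeg {f} 0≤f with em {Converges f}
    ... | yes (_ , f-s) = hasSum-nonNeg 0≤f f-s
    ... | no  _         = ≤-refl

    -- The value chosen by `∑` is pinned to 0 by applying `hasSum-nonNeg` to the family and to its
    -- negative.
    ∑-zero : (∀ π → f π ≈ 0#) → ∑ f ≈ 0#
    ∑-zero {f} f≈0 with em {Converges f}
    ... | no  _         = refl
    ... | yes (s , f-s) = antisym
      (≤-byDifference
        (hasSum-nonNeg
          (λ π → ≤-reflexive (sym (trans (*-congˡ (f≈0 π)) (zeroʳ _)))) (hasSum-neg f-s))
        (solve 1 (λ s → con (+ 0) := s :+ :- :1 :* s) refl s))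
      (hasSum-nonNeg (λ π → ≤-reflexive (sym (f≈0 π))) f-s)

    -- No convergence assumption: a divergent sum has the value 0.
    ∑-hasSum-* : ∀ (f : G → ℝ) → HasSum (λ π → ∑ f * f π) (∑ f * ∑ f)
    ∑-hasSum-* f with em {Converges f}
    ... | yes (s , f-s) = hasSum-* s f-s
    ... | no  _         = hasSum-cong (λ π → sym (zeroˡ (f π))) (sym (zeroˡ 0#)) hasSum-0

    -- The Cauchy-Schwarz inequality for weighted sums.

    module _ (w : G → ℝ) (0≤w : ∀ π → 0# ≤ w π) (a b : G → ℂ) where
      private
        P Q X Y : G → ℝ
        P π = w π * re (a π *ᶜ conj (a π))
        Q π = w π * re (b π *ᶜ conj (b π))
        X π = w π * re (a π *ᶜ conj (b π))
        Y π = w π * im (a π *ᶜ conj (b π))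

      -- Expand 0 ≤ ∑ w |t a − c b|² at c = ∑ w a b̄ and t = ∑ w |b|².
      cauchySchwarz : Converges P → Converges Q → ∑ Q ≉ 0# →
                      ∑ X ² + ∑ Y ² ≤ ∑ P * ∑ Q
      cauchySchwarz P-conv Q-conv ∑Q≉0 =
        -- The expansion sums to ∑ Q (∑ P ∑ Q - |c|²), and the positive factor ∑ Q is cancelled.
        *-cancelʳ-≤ (∑-nonNeg Q-nonNeg , ∑Q≉0 ∘ sym)
          (≤-byDifference (hasSum-nonNeg nonNeg hasSum)
            (solve 4 (λ p q x y → p :* q :* q :=
               (x :* x :+ y :* y) :* q
                 :+ (q :* q :* p :+ (x :* x :+ y :* y) :* q
                       :+ (:- (q :+ q)) :* (x :* x :+ y :* y)))
              refl (∑ P) (∑ Q) (∑ X) (∑ Y)))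
        where
        c₁ = ∑ X
        c₂ = ∑ Y
        t₀ = ∑ Q

        Q-nonNeg : ∀ π → 0# ≤ Q π
        Q-nonNeg π = *-nonNeg (w π) _ (0≤w π)
          (≤-respʳ-≈ (sym (re-*-conj (b π))) (x*x-nonNeg _))

        -- The mixed terms come multiplied by their own sums `c₁` and `c₂`, so that `∑-hasSum-*`
        -- applies to them.
        hasSum = hasSum-+
          (hasSum-+ (hasSum-* (t₀ * t₀) (∑-hasSum P-conv))
                    (hasSum-* (c₁ ² + c₂ ²) (∑-hasSum Q-conv)))
          (hasSum-* (- (t₀ + t₀)) (hasSum-+ (∑-hasSum-* X) (∑-hasSum-* Y)))

        nonNeg : ∀ π → 0# ≤ t₀ * t₀ * P π + (c₁ ² + c₂ ²) * Q π
                              + - (t₀ + t₀) * (c₁ * X π + c₂ * Y π)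
        nonNeg π = ≤-respʳ-≈
          -- Here p and q stand for `c₁` and `c₂`, the coordinates of c, and the left side is w |t a
          -- - c b|² in real coordinates.
          (solve 8 (λ w t p q a₁ a₂ b₁ b₂ →
               w :* (  (t :* a₁ :- (p :* b₁ :- q :* b₂)) :* (t :* a₁ :- (p :* b₁ :- q :* b₂))
                    :+ (t :* a₂ :- (p :* b₂ :+ q :* b₁)) :* (t :* a₂ :- (p :* b₂ :+ q :* b₁)))
             := t :* t :* (w :* (a₁ :* a₁ :- a₂ :* (:- a₂)))
             :+ (p :* p :+ q :* q) :* (w :* (b₁ :* b₁ :- b₂ :* (:- b₂)))
             :+ (:- (t :+ t)) :* (  p :* (w :* (a₁ :* b₁ :- a₂ :* (:- b₂)))
                                 :+ q :* (w :* (a₁ :* (:- b₂) :+ a₂ :* b₁))))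
            refl (w π) t₀ c₁ c₂ (re (a π)) (im (a π)) (re (b π)) (im (b π)))
          (*-nonNeg (w π) _ (0≤w π) (+-nonNeg (x*x-nonNeg _) (x*x-nonNeg _)))

-- The averages `Ψ₂` and the ratio `β`.

module WeightedAverages {ℓ : Level} (em : ExcludedMiddle ℓ) (R : CompleteOrderedField ℓ)
  {G : Set ℓ} (L : G → Analysis.ℂ em R) (w : G → CompleteOrderedField.Carrier R)
  (0≤w : ∀ π → CompleteOrderedField._≤_ R (CompleteOrderedField.0# R) (w π)) where
  open OrderedField em R
  open Analysis em R
  open Sums em R
  open Weighted L w
  open Relation.Binary.Reasoning.Setoid setoid

  private variable
    M N : G → ℂ

  SquareSummable : (G → ℂ) → Set ℓ
  SquareSummable M = Converges (λ π → w π * ∣ L π *ᶜ M π ∣ ²)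

  re-Ψ₂-nonNeg : ∀ M → 0# ≤ re (Ψ₂ M M)
  re-Ψ₂-nonNeg M = /-nonNeg
    (∑-nonNeg λ π → *-nonNeg (w π) _ (0≤w π)
      (≤-respʳ-≈ (sym (re-*-conj (L π *ᶜ M π))) (x*x-nonNeg _)))
    (∑-nonNeg 0≤w)

  im-Ψ₂≈0 : ∀ M → im (Ψ₂ M M) ≈ 0#
  im-Ψ₂≈0 M = begin
    im (Ψ₂ M M)          ≈⟨ x/y≈x*1/y _ (∑ w) ⟩
    _ * (1# / ∑ w)       ≈⟨ *-congʳ (∑-zero λ π →
                              trans (*-congˡ (im-*-conj (L π *ᶜ M π))) (zeroʳ (w π))) ⟩
    0# * (1# / ∑ w)      ≈⟨ zeroˡ _ ⟩
    0#                   ∎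

  -- `Ψ₂ M M` is a nonnegative real, its imaginary part being 0. Its nonvanishing as a complex
  -- number thus becomes the positivity that cancellation requires.
  Ψ₂≉0⇒0<re-Ψ₂ : Ψ₂ M M ≉ᶜ 0ᶜ → 0# < re (Ψ₂ M M)
  Ψ₂≉0⇒0<re-Ψ₂ {M} Ψ₂≉0 =
    re-Ψ₂-nonNeg M , λ 0≈re → Ψ₂≉0 (sym 0≈re , im-Ψ₂≈0 M)

  -- Cauchy-Schwarz for the sums, multiplied by the square of the common factor `1# / ∑ w`.
  Ψ₂-cauchySchwarz : SquareSummable M → SquareSummable N → Ψ₂ N N ≉ᶜ 0ᶜ →
                     ∣ Ψ₂ M N ∣ ² ≤ re (Ψ₂ M M) * re (Ψ₂ N N)
  Ψ₂-cauchySchwarz {M} {N} M-sq N-sq Ψ₂NN≉0 = ≤-resp-≈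
    (begin
      (∑ X ² + ∑ Y ²) * (v * v)
        ≈⟨ solve 3 (λ x y v → (x :* x :+ y :* y) :* (v :* v) :=
             x :* v :* (x :* v) :+ y :* v :* (y :* v)) refl (∑ X) (∑ Y) v ⟩
      ∑ X * v * (∑ X * v) + ∑ Y * v * (∑ Y * v)
        ≈⟨ +-cong (*-cong (÷ X) (÷ X)) (*-cong (÷ Y) (÷ Y)) ⟨
      re (Ψ₂ M N) ² + im (Ψ₂ M N) ²
        ≈⟨ ∣∣²≈ (Ψ₂ M N) ⟨
      ∣ Ψ₂ M N ∣ ²
        ∎)
    (begin
      ∑ P * ∑ Q * (v * v)
        ≈⟨ solve 3 (λ p q v → p :* q :* (v :* v) := p :* v :* (q :* v)) refl (∑ P) (∑ Q) v ⟩
      ∑ P * v * (∑ Q * v)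
        ≈⟨ *-cong (÷ P) (÷ Q) ⟨
      re (Ψ₂ M M) * re (Ψ₂ N N)
        ∎)
    (*-monoˡ-≤ (x*x-nonNeg v)
      (cauchySchwarz w 0≤w a b (summable M M-sq) (summable N N-sq) ∑Q≉0))
    where
    v = 1# / ∑ w

    a b : G → ℂ
    a π = L π *ᶜ M π
    b π = L π *ᶜ N π

    P Q X Y : G → ℝ
    P π = w π * re (a π *ᶜ conj (a π))
    Q π = w π * re (b π *ᶜ conj (b π))
    X π = w π * re (a π *ᶜ conj (b π))
    Y π = w π * im (a π *ᶜ conj (b π))

    ÷ : ∀ f → ∑ f / ∑ w ≈ ∑ f * v
    ÷ f = x/y≈x*1/y (∑ f) (∑ w)

    summable : ∀ M → SquareSummable M →
               Converges (λ π → w π * re ((L π *ᶜ M π) *ᶜ conj (L π *ᶜ M π)))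
    summable M (s , M-s) =
      s , hasSum-cong (λ π → *-congˡ (sym (re-*-conj (L π *ᶜ M π)))) refl M-s

    ∑Q≉0 : ∑ Q ≉ 0#
    -- A vanishing `∑ Q` would make the average `re (Ψ₂ N N)` vanish.
    ∑Q≉0 ∑Q≈0 = proj₂ (Ψ₂≉0⇒0<re-Ψ₂ {N} Ψ₂NN≉0)
      (sym (trans (÷ Q) (trans (*-congʳ ∑Q≈0) (zeroˡ v))))

  -- `β` branches on excluded middle; this lemma and `β-zero` expose its two branches as equations.
  β≈ : Ψ₂ M M ≉ᶜ 0ᶜ → β M ≈ ∣ Ψ M ∣ ² / re (Ψ₂ M M)
  β≈ {M} Ψ₂≉0 with em {Ψ₂ M M ≈ᶜ 0ᶜ}
  ... | yes Ψ₂≈0 = contradiction Ψ₂≈0 Ψ₂≉0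
  ... | no  _    = refl

  β-zero : Ψ₂ M M ≈ᶜ 0ᶜ → β M ≈ 0#
  β-zero {M} Ψ₂≈0 with em {Ψ₂ M M ≈ᶜ 0ᶜ}
  ... | yes _    = refl
  ... | no  Ψ₂≉0 = contradiction Ψ₂≈0 Ψ₂≉0

  β-nonNeg : ∀ M → 0# ≤ β M
  β-nonNeg M with em {Ψ₂ M M ≈ᶜ 0ᶜ}
  ... | yes _ = ≤-refl
  ... | no  _ = /-nonNeg (x*x-nonNeg _) (re-Ψ₂-nonNeg M)

-- Estimates in δ and comparison of quotients.

module Comparison {ℓ : Level} (em : ExcludedMiddle ℓ) (R : CompleteOrderedField ℓ) where
  open OrderedField em R
  open Analysis em R
  open Sums em R
  open Relation.Binary.Reasoning.Setoid setoid

  -- (1 + 4δ)(1 − δ)² = 1 + δ (2 − 7δ + 4δ²), and the bracket is nonnegative for δ ≤ 1/10.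
  1≤[1+4δ][1-δ]² : ∀ {δ} → 0# ≤ δ → fromℕ 10 * δ ≤ 1# →
                   1# ≤ (1# + fromℕ 4 * δ) * (1# - δ) ²
  1≤[1+4δ][1-δ]² {δ} 0≤δ 10δ≤1 = ≤-byDifference
    (*-nonNeg δ _ 0≤δ
      -- The bracket is split as 2(1 - 10δ) + 13δ + 4δ², with each summand nonnegative.
      (+-nonNeg (*-nonNeg (fromℕ 2) _ (fromℕ-nonNeg 2) (x≤y⇒0≤y-x 10δ≤1))
        (+-nonNeg (*-nonNeg (fromℕ 13) δ (fromℕ-nonNeg 13) 0≤δ)
                  (*-nonNeg (fromℕ 4) _ (fromℕ-nonNeg 4) (x*x-nonNeg δ)))))
    (solve 1 (λ δ → (:1 :+ :fromℕ 4 :* δ) :* ((:1 :- δ) :* (:1 :- δ)) :=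
       :1 :+ δ :* (:fromℕ 2 :* (:1 :- :fromℕ 10 :* δ)
                     :+ (:fromℕ 13 :* δ :+ :fromℕ 4 :* (δ :* δ)))) refl δ)

  -- Since 1 - δ = (1 - 10δ) + 9δ. This makes the smaller side of the hypothesis nonnegative, so
  -- that it may be squared.
  1-δ-nonNeg : ∀ {δ} → 0# ≤ δ → fromℕ 10 * δ ≤ 1# → 0# ≤ 1# - δ
  1-δ-nonNeg {δ} 0≤δ 10δ≤1 = ≤-respʳ-≈
    (solve 1 (λ δ → :1 :- :fromℕ 10 :* δ :+ :fromℕ 9 :* δ := :1 :- δ) refl δ)
    (+-nonNeg (x≤y⇒0≤y-x 10δ≤1) (*-nonNeg (fromℕ 9) δ (fromℕ-nonNeg 9) 0≤δ))

  -- Cancelling one `A` in the last premise leaves ε² n A ≤ m B. Multiplication by `κ` and κε² ≥ 1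
  -- give n A ≤ κ m B, which is the claim with denominators cleared. It is applied with A = Ψ_{M,M},
  -- B = Ψ_{N,N}, m = |Ψ_M|², n = |Ψ_N|², ε = 1 - δ and κ = 1 + 4δ.
  quotient-bound : ∀ {κ ε A B m n} → 0# ≤ κ → 0# < A → 0# < B → 0# ≤ n →
                   1# ≤ κ * ε ² → ε ² * n * A ² ≤ m * (A * B) →
                   n / B ≤ κ * (m / A)
  quotient-bound {κ} {ε} {A} {B} {m} {n} 0≤κ 0<A@(0≤A , 0≉A) 0<B@(0≤B , 0≉B) 0≤n 1≤κε² h =
    *-cancelʳ-≤ (*-pos 0<B 0<A) (≤-resp-≈
      (begin
        1# * (n * A)     ≈⟨ *-identityˡ (n * A) ⟩
        n * A            ≈⟨ *-congʳ (x/y*y≈x n (0≉B ∘ sym)) ⟨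
        n / B * B * A    ≈⟨ solve 3 (λ q B A → q :* B :* A := q :* (B :* A)) refl (n / B) B A ⟩
        n / B * (B * A)  ∎)
      (begin
        κ * (m * B)            ≈⟨ *-congˡ (*-congʳ (x/y*y≈x m (0≉A ∘ sym))) ⟨
        κ * (m / A * A * B)    ≈⟨ solve 4 (λ κ q A B → κ :* (q :* A :* B) := κ :* q :* (B :* A))
                                    refl κ (m / A) A B ⟩
        κ * (m / A) * (B * A)  ∎)
      (≤-trans
        (*-monoˡ-≤ (*-nonNeg n A 0≤n 0≤A) 1≤κε²)
        (≤-respˡ-≈
          (solve 4 (λ κ e n A → κ :* (e :* n :* A) := κ :* e :* (n :* A)) refl κ (ε ²) n A)
          (*-monoʳ-≤ 0≤κ (*-cancelʳ-≤ 0<A (≤-resp-≈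
            (solve 2 (λ k A → k :* (A :* A) := k :* A :* A) refl (ε ² * n) A)
            (solve 3 (λ m A B → m :* (A :* B) := m :* B :* A) refl m A B)
            h))))))

theorem2p4 : {ℓ : Level} (em : ExcludedMiddle ℓ) (R : CompleteOrderedField ℓ) →
    let open CompleteOrderedField R renaming (Carrier to ℝ)
        open Analysis em R
    in
    (G : Set ℓ) (L : G → ℂ) (w : G → ℝ) →
    (∀ π → 0# ≤ w π) →
    ¬ (∀ π → w π ≈ 0#) →
    let open Weighted L w in
    (δ : ℝ) → 0# ≤ δ → δ < 1# / fromℕ 10 →
    (M N : G → ℂ) →
    Converges w →
    Converges (λ π → w π * ∣ L π *ᶜ M π ∣ ²) →
    Converges (λ π → w π * ∣ L π *ᶜ N π ∣ ²) →
    Ψ₂ M M ≉ᶜ 0ᶜ →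
    (1# - δ) * ∣ Ψ N ∣ * re (Ψ₂ M M) ≤ ∣ Ψ M *ᶜ Ψ₂ M N ∣ →
    β N ≤ (1# + fromℕ 4 * δ) * β M
theorem2p4 em R G L w 0≤w _ δ 0≤δ (δ≤1/10 , _) M N _ M-sq N-sq Ψ₂MM≉0 hyp =
  conclusion em
  where
  open OrderedField em R
  open Analysis em R
  open Weighted L w
  open Sums em R
  open Comparison em R
  open WeightedAverages em R L w 0≤w

  10δ≤1 : fromℕ 10 * δ ≤ 1#
  10δ≤1 = x≤1/y⇒y*x≤1 (fromℕ-nonNeg 10) δ≤1/10

  κ-nonNeg : 0# ≤ 1# + fromℕ 4 * δ
  κ-nonNeg = +-nonNeg 0≤1 (*-nonNeg (fromℕ 4) δ (fromℕ-nonNeg 4) 0≤δ)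

  -- Squaring is monotone on nonnegative numbers, and Cauchy-Schwarz then replaces |Ψ_{M,N}|² by the
  -- product of the two diagonal averages.
  squared-hyp : Ψ₂ N N ≉ᶜ 0ᶜ →
    (1# - δ) ² * ∣ Ψ N ∣ ² * re (Ψ₂ M M) ² ≤ ∣ Ψ M ∣ ² * (re (Ψ₂ M M) * re (Ψ₂ N N))
  squared-hyp Ψ₂NN≉0 = ≤-trans
    (≤-resp-≈
      (solve 3 (λ x y z → x :* y :* z :* (x :* y :* z) := x :* x :* (y :* y) :* (z :* z))
        refl (1# - δ) ∣ Ψ N ∣ (re (Ψ₂ M M)))
      (∣∣²-*ᶜ (Ψ M) (Ψ₂ M N))
      (*-mono-square
        (*-nonNeg _ _ (*-nonNeg _ _ (1-δ-nonNeg 0≤δ 10δ≤1) (√-nonNeg _)) (re-Ψ₂-nonNeg M))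
        hyp))
    (*-monoʳ-≤ (x*x-nonNeg ∣ Ψ M ∣) (Ψ₂-cauchySchwarz {M} {N} M-sq N-sq Ψ₂NN≉0))

  conclusion : Dec (Ψ₂ N N ≈ᶜ 0ᶜ) → β N ≤ (1# + fromℕ 4 * δ) * β M
  -- Here `β N` has its default value 0, and the right side is nonnegative.
  conclusion (yes Ψ₂NN≈0) =
    ≤-respˡ-≈ (sym (β-zero {N} Ψ₂NN≈0)) (*-nonNeg _ _ κ-nonNeg (β-nonNeg M))
  conclusion (no Ψ₂NN≉0) = ≤-resp-≈
    (sym (β≈ {N} Ψ₂NN≉0)) (*-congˡ (sym (β≈ {M} Ψ₂MM≉0)))
    (quotient-bound κ-nonNeg (Ψ₂≉0⇒0<re-Ψ₂ {M} Ψ₂MM≉0) (Ψ₂≉0⇒0<re-Ψ₂ {N} Ψ₂NN≉0)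
      (x*x-nonNeg ∣ Ψ N ∣) (1≤[1+4δ][1-δ]² 0≤δ 10δ≤1) (squared-hyp Ψ₂NN≉0))
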